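{- Let $n$ be a nonnegative integer. Then the sequence $E_{n,n},E_{n,n-1},\ldots,E_{n,0}$ of Entringer numbers is log-concave.
   Context: The Entringer numbers $E_{n,k}$, $0\le k\le n$, are defined by $E_{n,0}=0$ for all $n\ge0$, $E_{1,1}=1$, and for $n\ge2$ the recurrence $E_{n,k}=\sum_{i=0}^{k-1}E_{n-1,n-1-i}$ for $1\le k\le n$. (For example, the rows $n=3,4,5$ for $k=0,\ldots,n$ are $0,1,2,2$; $0,2,4,5,5$; $0,5,10,14,16,16$.) A sequence $s_0,\ldots,s_N$ of nonnegative integers is log-concave if $s_i^2\ge s_{i-1}s_{i+1}$ for $0<i<N$. -}

module Defs where

open import Data.Nat using (ℕ; zero; suc; _*_; _^_; _∸_; _<_; _≥_)
open import Data.List using (applyUpTo; _∷_; [])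
open import Data.Nat.ListAction using (sum)
open import Relation.Binary.PropositionalEquality using (_≡_; refl)

-- The numbers E n k are meaningful for k ≤ n only.  For k ≤ n every
-- truncated subtraction below is exact, since i < k; the values at k > n
-- are arbitrary and never enter a value at k ≤ n.
E : ℕ → ℕ → ℕ
E zero          _       = 0
E (suc _)       zero    = 0
E (suc zero)    (suc _) = 1
E (suc (suc m)) (suc k) = sum (applyUpTo (λ i → E (suc m) (suc m ∸ i)) (suc k))

_ : applyUpTo (E 3) 4 ≡ 0 ∷ 1 ∷ 2 ∷ 2 ∷ []
_ = refl

_ : applyUpTo (E 4) 5 ≡ 0 ∷ 2 ∷ 4 ∷ 5 ∷ 5 ∷ []
_ = refl

_ : applyUpTo (E 5) 6 ≡ 0 ∷ 5 ∷ 10 ∷ 14 ∷ 16 ∷ 16 ∷ []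
_ = refl

-- Log-concavity of the finite sequence s 0 , … , s N.  No value of s beyond
-- index N is inspected, and 0 < i makes i ∸ 1 the true predecessor.
LogConcave : ℕ → (ℕ → ℕ) → Set
LogConcave N s = ∀ i → 0 < i → i < N → s i ^ 2 ≥ s (i ∸ 1) * s (suc i)

{-# OPTIONS --safe #-}

-- Consecutive entries of row n differ by entries of row n - 1 read backwards.
-- Row n - 1 is nondecreasing, so row n is concave, and a concave sequence of
-- nonnegative numbers is log-concave.
module Submission where

open import Defs
open import Data.Nat using (ℕ; zero; suc; _+_; _*_; _^_; _∸_; _≤_; z≤n; s≤s; s≤s⁻¹)
open import Data.Nat.Properties
open import Data.Nat.ListAction using (sum)
open import Data.Nat.ListAction.Properties using (sum-++)
open import Data.List using (applyUpTo; [_]; _∷ʳ_)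
open import Data.List.Properties using (applyUpTo-∷ʳ)
open import Relation.Binary.PropositionalEquality using (_≡_; sym; cong; module ≡-Reasoning)

-- By `E-suc` the increments of a row are Entringer numbers, so they are nonnegative and every row
-- rises. Each row's increments therefore shrink from left to right. For consecutive entries `a`,
-- `b = a + p`, `c = b + q` this gives b² - ca = bp - qa ≥ 0, as `a ≤ b` and `q ≤ p`. The condition
-- is symmetric under reversal.

sum-applyUpTo-suc : ∀ (f : ℕ → ℕ) k → sum (applyUpTo f (suc k)) ≡ sum (applyUpTo f k) + f k
sum-applyUpTo-suc f k = begin
  sum (applyUpTo f (suc k))          ≡⟨ cong sum (applyUpTo-∷ʳ f k) ⟨
  sum (applyUpTo f k ∷ʳ f k)         ≡⟨ sum-++ (applyUpTo f k) [ f k ] ⟩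
  sum (applyUpTo f k) + sum [ f k ]  ≡⟨ cong (sum (applyUpTo f k) +_) (+-identityʳ (f k)) ⟩
  sum (applyUpTo f k) + f k          ∎
  where open ≡-Reasoning

-- The defining sums for `k` and `suc k` differ only in their last term.
E-suc : ∀ m k → E (2 + m) (suc k) ≡ E (2 + m) k + E (suc m) (suc m ∸ k)
E-suc m zero    = +-identityʳ _
E-suc m (suc k) = sum-applyUpTo-suc (λ i → E (suc m) (suc m ∸ i)) (suc k)

E-≤-suc : ∀ n k → E n k ≤ E n (suc k)
E-≤-suc zero          k       = z≤n
E-≤-suc (suc zero)    zero    = z≤n
E-≤-suc (suc zero)    (suc k) = ≤-refl
E-≤-suc (suc (suc m)) k rewrite E-suc m k = m≤m+n _ _

-- Monotonicity of a row read backwards; with `E-suc` it makes the next row concave.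
E-∸-suc-≤ : ∀ n l k → E n (l ∸ suc k) ≤ E n (l ∸ k)
E-∸-suc-≤ n zero    k       rewrite 0∸n≡0 k = ≤-refl
E-∸-suc-≤ n (suc l) zero    = E-≤-suc n l
E-∸-suc-≤ n (suc l) (suc k) = E-∸-suc-≤ n l k

concave⇒logConcave : ∀ {a b c p q} → b ≡ a + p → c ≡ b + q → q ≤ p → c * a ≤ b ^ 2
concave⇒logConcave {a} {b} {c} {p} {q} b≡a+p c≡b+q q≤p = begin
  c * a          ≡⟨ cong (_* a) c≡b+q ⟩
  (b + q) * a    ≡⟨ *-distribʳ-+ a b q ⟩
  b * a + q * a  ≤⟨ +-monoʳ-≤ (b * a) (*-mono-≤ q≤p a≤b) ⟩
  b * a + p * b  ≡⟨ cong (b * a +_) (*-comm p b) ⟩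
  b * a + b * p  ≡⟨ *-distribˡ-+ b a p ⟨
  b * (a + p)    ≡⟨ cong (b *_) b≡a+p ⟨
  b * b          ≡⟨ cong (b *_) (*-identityʳ b) ⟨
  b ^ 2          ∎
  where
  open ≤-Reasoning
  a≤b : a ≤ b
  a≤b = ≤-trans (m≤m+n a p) (≤-reflexive (sym b≡a+p))

corollary7p6 : (n : ℕ) → LogConcave n (λ j → E n (n ∸ j))
corollary7p6 (suc zero)    (suc j) _ (s≤s ())
corollary7p6 (suc (suc m)) (suc j) _ j+1<m+2
  -- Since `j ≤ m`, no subtraction truncates: with `k = m ∸ j`, the entries at `j`, `suc j`, `2 + j`
  -- of the reversed row have column indices `2 + k`, `1 + k`, `k`.
  rewrite +-∸-assoc 2 (s≤s⁻¹ (s≤s⁻¹ j+1<m+2)) | +-∸-assoc 1 (s≤s⁻¹ (s≤s⁻¹ j+1<m+2)) =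
  concave⇒logConcave (E-suc m k) (E-suc m (suc k)) (E-∸-suc-≤ (suc m) (suc m) k)
  where
  k : ℕ
  k = m ∸ j
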